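{- Let $\ell:K(H\times\mathrm{Id})\to HM$ be an abstract GSOS rule with $\ell$-interpretation $b:KC\to C$, let $k=c^{ -1}\cdot Hb^\sharp:HMC\to C$ and $k'=b^\sharp\cdot Mk:MHMC\to C$. Then $(C,k')$ is a completely iterative algebra for the functor $MHM$.
   Context: Let $\mathcal A$ be a category with binary products and coproducts, let $H:\mathcal A\to\mathcal A$ be a functor with a terminal coalgebra $c:C\to HC$ (so $c$ is an isomorphism by Lambek's lemma), and let $K:\mathcal A\to\mathcal A$ be a functor such that every object $X$ has a free $K$-algebra $\varphi_X:KMX\to MX$ with universal morphism $\eta_X:X\to MX$. Then $(M,\eta,\mu)$ is the free monad on $K$, and $\kappa=\varphi\cdot K\eta:K\to M$. For a $K$-algebra $a:KA\to A$ let $a^\sharp:MA\to A$ be the unique $K$-algebra homomorphism with $a^\sharp\cdot\eta_A=\mathrm{id}_A$; it is an Eilenberg–Moore algebra for $M$. An abstract GSOS rule is a natural transformation $\ell:K(H\times\mathrm{Id})\to HM$; its $\ell$-interpretation is the unique morphism $b:KC\to C$ with $c\cdot b=Hb^\sharp\cdot\ell_C\cdot K\langle c,\mathrm{id}_C\rangle$. For an endofunctor $G$, a flat equation morphism in an object $A$ is a morphism $e:X\to GX+A$; a $G$-algebra $a:GA\to A$ is a completely iterative algebra (cia) if every flat equation morphism $e:X\to GX+A$ has a unique solution, i.e. a unique $e^\dagger:X\to A$ with $e^\dagger=[a,\mathrm{id}_A]\cdot(Ge^\dagger+\mathrm{id}_A)\cdot e$. -}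

module Defs where

open import Level using (Level; _⊔_; suc)
open import Data.Product using (∃!; _,_; proj₁; proj₂) renaming (_×_ to _∧_)
open import Relation.Binary using (Rel; IsEquivalence; Setoid)
import Relation.Binary.Reasoning.Setoid as SetoidReasoning

-- Hom-sets are setoids: equality of morphisms is `_≈_` throughout.

record Category (o h e : Level) : Set (suc (o ⊔ h ⊔ e)) where
  infix  4 _≈_ _⇒_
  infixr 9 _∘_
  field
    Obj : Set o
    _⇒_ : Obj → Obj → Set h
    _≈_ : ∀ {A B} → Rel (A ⇒ B) e
    id  : ∀ {A} → A ⇒ A
    _∘_ : ∀ {A B C} → B ⇒ C → A ⇒ B → A ⇒ C

    isEquivalence : ∀ {A B} → IsEquivalence (_≈_ {A} {B})
    ∘-cong        : ∀ {A B C} {f f′ : B ⇒ C} {g g′ : A ⇒ B} → f ≈ f′ → g ≈ g′ → f ∘ g ≈ f′ ∘ g′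
    assoc         : ∀ {A B C D} {f : A ⇒ B} {g : B ⇒ C} {k : C ⇒ D} → (k ∘ g) ∘ f ≈ k ∘ (g ∘ f)
    identityˡ     : ∀ {A B} {f : A ⇒ B} → id ∘ f ≈ f
    identityʳ     : ∀ {A B} {f : A ⇒ B} → f ∘ id ≈ f

  module Equiv {A B : Obj} = IsEquivalence (isEquivalence {A} {B})
  open Equiv public using (refl; sym; trans)

  homSetoid : Obj → Obj → Setoid h e
  homSetoid A B = record { Carrier = A ⇒ B ; _≈_ = _≈_ ; isEquivalence = isEquivalence }

  module HomReasoning {A B : Obj} = SetoidReasoning (homSetoid A B)

  ∘-congˡ : ∀ {A B C} {f : B ⇒ C} {g g′ : A ⇒ B} → g ≈ g′ → f ∘ g ≈ f ∘ g′
  ∘-congˡ p = ∘-cong refl p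

  ∘-congʳ : ∀ {A B C} {f f′ : B ⇒ C} {g : A ⇒ B} → f ≈ f′ → f ∘ g ≈ f′ ∘ g
  ∘-congʳ p = ∘-cong p refl

  pullˡ : ∀ {A B C D} {f : A ⇒ B} {g : B ⇒ C} {k : C ⇒ D} {m : B ⇒ D} →
          k ∘ g ≈ m → k ∘ (g ∘ f) ≈ m ∘ f
  pullˡ p = trans (sym assoc) (∘-congʳ p)

  extendˡ : ∀ {A B C C′ D} {f : A ⇒ B} {g : B ⇒ C} {k : C ⇒ D} {g′ : B ⇒ C′} {k′ : C′ ⇒ D} →
            k ∘ g ≈ k′ ∘ g′ → k ∘ (g ∘ f) ≈ k′ ∘ (g′ ∘ f)
  extendˡ p = trans (pullˡ p) assoc

record Functor {o h e o′ h′ e′ : Level} (𝒜 : Category o h e) (ℬ : Category o′ h′ e′)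
               : Set (o ⊔ h ⊔ e ⊔ o′ ⊔ h′ ⊔ e′) where
  private
    module 𝒜 = Category 𝒜
    module ℬ = Category ℬ
  field
    F₀ : 𝒜.Obj → ℬ.Obj
    F₁ : ∀ {A B} → A 𝒜.⇒ B → F₀ A ℬ.⇒ F₀ B

    F-cong   : ∀ {A B} {f g : A 𝒜.⇒ B} → f 𝒜.≈ g → F₁ f ℬ.≈ F₁ g
    identity : ∀ {A} → F₁ (𝒜.id {A}) ℬ.≈ ℬ.id
    homomorphism : ∀ {A B C} {f : A 𝒜.⇒ B} {g : B 𝒜.⇒ C} → F₁ (g 𝒜.∘ f) ℬ.≈ F₁ g ℬ.∘ F₁ f

Endofunctor : {o h e : Level} → Category o h e → Set (o ⊔ h ⊔ e)
Endofunctor 𝒜 = Functor 𝒜 𝒜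

Id : {o h e : Level} {𝒜 : Category o h e} → Endofunctor 𝒜
Id {𝒜 = 𝒜} = record
  { F₀ = λ A → A ; F₁ = λ f → f ; F-cong = λ p → p ; identity = refl ; homomorphism = refl }
  where open Category 𝒜

infixr 9 _∘F_
_∘F_ : {o h e : Level} {𝒜 : Category o h e} → Endofunctor 𝒜 → Endofunctor 𝒜 → Endofunctor 𝒜
_∘F_ {𝒜 = 𝒜} G F = record
  { F₀           = λ A → G.F₀ (F.F₀ A)
  ; F₁           = λ f → G.F₁ (F.F₁ f)
  ; F-cong       = λ p → G.F-cong (F.F-cong p)
  ; identity     = trans (G.F-cong F.identity) G.identity
  ; homomorphism = trans (G.F-cong F.homomorphism) G.homomorphism
  }
  where
    open Category 𝒜
    module G = Functor G
    module F = Functor F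

record NaturalTransformation {o h e o′ h′ e′ : Level} {𝒜 : Category o h e} {ℬ : Category o′ h′ e′}
                             (F G : Functor 𝒜 ℬ) : Set (o ⊔ h ⊔ h′ ⊔ e′) where
  private
    module 𝒜 = Category 𝒜
    module F = Functor F
    module G = Functor G
  open Category ℬ
  field
    component : ∀ X → F.F₀ X ⇒ G.F₀ X
    commute   : ∀ {X Y} (f : X 𝒜.⇒ Y) → component Y ∘ F.F₁ f ≈ G.F₁ f ∘ component X

record BinaryProducts {o h e : Level} (𝒜 : Category o h e) : Set (o ⊔ h ⊔ e) where
  open Category 𝒜
  infixr 7 _×_
  field
    _×_   : Obj → Obj → Obj
    π₁    : ∀ {A B} → A × B ⇒ A
    π₂    : ∀ {A B} → A × B ⇒ B
    ⟨_,_⟩ : ∀ {X A B} → X ⇒ A → X ⇒ B → X ⇒ A × B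

    project₁ : ∀ {X A B} {f : X ⇒ A} {g : X ⇒ B} → π₁ ∘ ⟨ f , g ⟩ ≈ f
    project₂ : ∀ {X A B} {f : X ⇒ A} {g : X ⇒ B} → π₂ ∘ ⟨ f , g ⟩ ≈ g
    unique   : ∀ {X A B} {f : X ⇒ A} {g : X ⇒ B} {k : X ⇒ A × B} →
               π₁ ∘ k ≈ f → π₂ ∘ k ≈ g → ⟨ f , g ⟩ ≈ k

  ⟨⟩-cong : ∀ {X A B} {f f′ : X ⇒ A} {g g′ : X ⇒ B} → f ≈ f′ → g ≈ g′ → ⟨ f , g ⟩ ≈ ⟨ f′ , g′ ⟩
  ⟨⟩-cong p q = unique (trans project₁ (sym p)) (trans project₂ (sym q))

  ⟨⟩∘ : ∀ {X Y A B} {f : X ⇒ A} {g : X ⇒ B} {k : Y ⇒ X} → ⟨ f , g ⟩ ∘ k ≈ ⟨ f ∘ k , g ∘ k ⟩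
  ⟨⟩∘ = sym (unique (pullˡ project₁) (pullˡ project₂))

  infixr 7 _×₁_
  _×₁_ : ∀ {A A′ B B′} → A ⇒ A′ → B ⇒ B′ → A × B ⇒ A′ × B′
  f ×₁ g = ⟨ f ∘ π₁ , g ∘ π₂ ⟩

  ×₁∘⟨⟩ : ∀ {X A A′ B B′} {f : A ⇒ A′} {g : B ⇒ B′} {p : X ⇒ A} {q : X ⇒ B} →
          (f ×₁ g) ∘ ⟨ p , q ⟩ ≈ ⟨ f ∘ p , g ∘ q ⟩
  ×₁∘⟨⟩ = trans ⟨⟩∘ (⟨⟩-cong (trans assoc (∘-congˡ project₁)) (trans assoc (∘-congˡ project₂)))

  infixr 7 _×F_
  _×F_ : Endofunctor 𝒜 → Endofunctor 𝒜 → Endofunctor 𝒜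
  F ×F G = record
    { F₀           = λ A → F.F₀ A × G.F₀ A
    ; F₁           = λ f → F.F₁ f ×₁ G.F₁ f
    ; F-cong       = λ p → ⟨⟩-cong (∘-congʳ (F.F-cong p)) (∘-congʳ (G.F-cong p))
    ; identity     = unique (trans identityʳ (sym (trans (∘-congʳ F.identity) identityˡ)))
                            (trans identityʳ (sym (trans (∘-congʳ G.identity) identityˡ)))
    ; homomorphism = sym (trans ×₁∘⟨⟩ (⟨⟩-cong (pullˡ (sym F.homomorphism)) (pullˡ (sym G.homomorphism))))
    }
    where
      module F = Functor F
      module G = Functor G

record BinaryCoproducts {o h e : Level} (𝒜 : Category o h e) : Set (o ⊔ h ⊔ e) where
  open Category 𝒜
  infixr 6 _+_
  field
    _+_   : Obj → Obj → Obj
    i₁    : ∀ {A B} → A ⇒ A + B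
    i₂    : ∀ {A B} → B ⇒ A + B
    [_,_] : ∀ {X A B} → A ⇒ X → B ⇒ X → A + B ⇒ X

    inject₁ : ∀ {X A B} {f : A ⇒ X} {g : B ⇒ X} → [ f , g ] ∘ i₁ ≈ f
    inject₂ : ∀ {X A B} {f : A ⇒ X} {g : B ⇒ X} → [ f , g ] ∘ i₂ ≈ g
    unique  : ∀ {X A B} {f : A ⇒ X} {g : B ⇒ X} {k : A + B ⇒ X} →
              k ∘ i₁ ≈ f → k ∘ i₂ ≈ g → [ f , g ] ≈ k

  infixr 6 _+₁_
  _+₁_ : ∀ {A A′ B B′} → A ⇒ A′ → B ⇒ B′ → A + B ⇒ A′ + B′
  f +₁ g = [ i₁ ∘ f , i₂ ∘ g ]

module _ {o h e : Level} {𝒜 : Category o h e} where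
  open Category 𝒜

  module _ (F : Endofunctor 𝒜) where
    open Functor F

    IsAlgebraHom : ∀ {A B} → F₀ A ⇒ A → F₀ B ⇒ B → A ⇒ B → Set e
    IsAlgebraHom a b f = f ∘ a ≈ b ∘ F₁ f

    IsCoalgebraHom : ∀ {A B} → A ⇒ F₀ A → B ⇒ F₀ B → A ⇒ B → Set e
    IsCoalgebraHom a b f = b ∘ f ≈ F₁ f ∘ a

  record TerminalCoalgebra (H : Endofunctor 𝒜) : Set (o ⊔ h ⊔ e) where
    private module H = Functor H
    field
      C : Obj
      c : C ⇒ H.F₀ C
      terminal : ∀ {X} (x : X ⇒ H.F₀ X) → ∃! _≈_ (IsCoalgebraHom H x c)

    unfold : ∀ {X} → X ⇒ H.F₀ X → X ⇒ C
    unfold x = proj₁ (terminal x)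

    unfold-hom : ∀ {X} (x : X ⇒ H.F₀ X) → IsCoalgebraHom H x c (unfold x)
    unfold-hom x = proj₁ (proj₂ (terminal x))

    hom-unique : ∀ {X} {x : X ⇒ H.F₀ X} {f g : X ⇒ C} →
                 IsCoalgebraHom H x c f → IsCoalgebraHom H x c g → f ≈ g
    hom-unique {x = x} p q = trans (sym (proj₂ (proj₂ (terminal x)) p)) (proj₂ (proj₂ (terminal x)) q)

    -- Lambek's lemma: c⁻¹ is a two-sided inverse of c.
    c⁻¹ : H.F₀ C ⇒ C
    c⁻¹ = unfold (H.F₁ c)

    c⁻¹∘c : c⁻¹ ∘ c ≈ id
    c⁻¹∘c = hom-unique
      (trans (pullˡ (unfold-hom (H.F₁ c))) (∘-congʳ (sym H.homomorphism)))
      (trans identityʳ (sym (trans (∘-congʳ H.identity) identityˡ)))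

    c∘c⁻¹ : c ∘ c⁻¹ ≈ id
    c∘c⁻¹ = trans (unfold-hom (H.F₁ c))
      (trans (sym H.homomorphism) (trans (H.F-cong c⁻¹∘c) H.identity))

  record FreeAlgebra (K : Endofunctor 𝒜) (X : Obj) : Set (o ⊔ h ⊔ e) where
    private module K = Functor K
    field
      carrier : Obj
      φ : K.F₀ carrier ⇒ carrier
      η : X ⇒ carrier
      free : ∀ {A} (a : K.F₀ A ⇒ A) (f : X ⇒ A) →
             ∃! _≈_ λ g → IsAlgebraHom K φ a g ∧ g ∘ η ≈ f

  module _ (coprod : BinaryCoproducts 𝒜) (G : Endofunctor 𝒜) where
    open BinaryCoproducts coprod
    open Functor G

    IsSolution : ∀ {A X} → F₀ A ⇒ A → X ⇒ F₀ X + A → X ⇒ A → Set e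
    IsSolution a eq s = s ≈ [ a , id ] ∘ (F₁ s +₁ id) ∘ eq

    IsCompletelyIterative : ∀ {A} → F₀ A ⇒ A → Set (o ⊔ h ⊔ e)
    IsCompletelyIterative {A} a = ∀ {X} (eq : X ⇒ F₀ X + A) → ∃! _≈_ (IsSolution a eq)

module FreeMonad {o h e : Level} {𝒜 : Category o h e} (K : Endofunctor 𝒜)
                 (freeAlgebra : ∀ X → FreeAlgebra K X) where
  open Category 𝒜
  private
    module K = Functor K
    module Free X = FreeAlgebra (freeAlgebra X)

  M₀ : Obj → Obj
  M₀ = Free.carrier

  φ : ∀ X → K.F₀ (M₀ X) ⇒ M₀ X
  φ = Free.φ

  η : ∀ X → X ⇒ M₀ X
  η = Free.η

  ext : ∀ {X A} → K.F₀ A ⇒ A → X ⇒ A → M₀ X ⇒ A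
  ext {X} a f = proj₁ (Free.free X a f)

  ext-hom : ∀ {X A} (a : K.F₀ A ⇒ A) (f : X ⇒ A) → IsAlgebraHom K (φ X) a (ext a f)
  ext-hom {X} a f = proj₁ (proj₁ (proj₂ (Free.free X a f)))

  ext-η : ∀ {X A} (a : K.F₀ A ⇒ A) (f : X ⇒ A) → ext a f ∘ η X ≈ f
  ext-η {X} a f = proj₂ (proj₁ (proj₂ (Free.free X a f)))

  ext-unique : ∀ {X A} {a : K.F₀ A ⇒ A} {f : X ⇒ A} {g : M₀ X ⇒ A} →
               IsAlgebraHom K (φ X) a g → g ∘ η X ≈ f → ext a f ≈ g
  ext-unique {X} {a = a} {f = f} p q = proj₂ (proj₂ (Free.free X a f)) (p , q)

  ∘-hom : ∀ {A B D} {a : K.F₀ A ⇒ A} {b : K.F₀ B ⇒ B} {d : K.F₀ D ⇒ D} {g : B ⇒ D} {f : A ⇒ B} →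
          IsAlgebraHom K b d g → IsAlgebraHom K a b f → IsAlgebraHom K a d (g ∘ f)
  ∘-hom {a = a} {b} {d} {g} {f} p q = begin
    (g ∘ f) ∘ a            ≈⟨ assoc ⟩
    g ∘ (f ∘ a)            ≈⟨ ∘-congˡ q ⟩
    g ∘ (b ∘ K.F₁ f)       ≈⟨ extendˡ p ⟩
    d ∘ (K.F₁ g ∘ K.F₁ f)  ≈⟨ ∘-congˡ K.homomorphism ⟨
    d ∘ K.F₁ (g ∘ f)       ∎
    where open HomReasoning

  id-hom : ∀ {A} {a : K.F₀ A ⇒ A} → IsAlgebraHom K a a id
  id-hom = trans identityˡ (sym (trans (∘-congˡ K.identity) identityʳ))

  M₁ : ∀ {X Y} → X ⇒ Y → M₀ X ⇒ M₀ Y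
  M₁ {Y = Y} f = ext (φ Y) (η Y ∘ f)

  M : Endofunctor 𝒜
  M = record
    { F₀           = M₀
    ; F₁           = M₁
    ; F-cong       = λ p → ext-unique (ext-hom _ _) (trans (ext-η _ _) (∘-congˡ (sym p)))
    ; identity     = ext-unique id-hom (trans identityˡ (sym identityʳ))
    ; homomorphism = ext-unique (∘-hom (ext-hom _ _) (ext-hom _ _))
                       (trans assoc (trans (∘-congˡ (ext-η _ _)) (extendˡ (ext-η _ _))))
    }

  infix 10 _♯
  _♯ : ∀ {A} → K.F₀ A ⇒ A → M₀ A ⇒ A
  a ♯ = ext a id

  μ : ∀ X → M₀ (M₀ X) ⇒ M₀ X
  μ X = φ X ♯

  κ : ∀ X → K.F₀ X ⇒ M₀ X
  κ X = φ X ∘ K.F₁ (η X)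

  ♯∘M₁ : ∀ {X A} {a : K.F₀ A ⇒ A} {f : X ⇒ A} → a ♯ ∘ M₁ f ≈ ext a f
  ♯∘M₁ = sym (ext-unique (∘-hom (ext-hom _ _) (ext-hom _ _))
    (trans assoc (trans (∘-congˡ (ext-η _ _)) (trans (pullˡ (ext-η _ _)) identityˡ))))

  hom∘ext : ∀ {X A B} {a : K.F₀ A ⇒ A} {b : K.F₀ B ⇒ B} {f : X ⇒ A} {g : A ⇒ B} →
            IsAlgebraHom K a b g → ext b (g ∘ f) ≈ g ∘ ext a f
  hom∘ext p = ext-unique (∘-hom p (ext-hom _ _)) (trans assoc (∘-congˡ (ext-η _ _)))

  ext∘κ : ∀ {X A} {a : K.F₀ A ⇒ A} {f : X ⇒ A} → ext a f ∘ κ X ≈ a ∘ K.F₁ f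
  ext∘κ = trans (extendˡ (ext-hom _ _)) (∘-congˡ (trans (sym K.homomorphism) (K.F-cong (ext-η _ _))))

module GSOS {o h e : Level} {𝒜 : Category o h e} (prod : BinaryProducts 𝒜)
            (H : Endofunctor 𝒜) (T : TerminalCoalgebra H)
            (K : Endofunctor 𝒜) (freeAlgebra : ∀ X → FreeAlgebra K X) where
  open Category 𝒜
  open BinaryProducts prod
  open TerminalCoalgebra T
  open FreeMonad K freeAlgebra
  private
    module H = Functor H
    module K = Functor K
    module M = Functor M
  open NaturalTransformation using (component; commute)

  GSOSRule : Set (o ⊔ h ⊔ e)
  GSOSRule = NaturalTransformation (K ∘F (H ×F Id)) (H ∘F M)

  -- By interpretation-∃! below, this equation has exactly one solution b.
  IsInterpretation : GSOSRule → K.F₀ C ⇒ C → Set e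
  IsInterpretation ℓ b = c ∘ b ≈ H.F₁ (b ♯) ∘ component ℓ C ∘ K.F₁ ⟨ c , id ⟩

  module _ (ℓ : GSOSRule) where
    IsBialgebra : ∀ {Y} → K.F₀ Y ⇒ Y → Y ⇒ H.F₀ Y → Set e
    IsBialgebra {Y} a y = y ∘ a ≈ H.F₁ (a ♯) ∘ component ℓ Y ∘ K.F₁ ⟨ y , id ⟩

    pairAlg : ∀ {Y} → K.F₀ Y ⇒ Y → K.F₀ (H.F₀ Y × Y) ⇒ H.F₀ Y × Y
    pairAlg {Y} a = ⟨ H.F₁ (a ♯) ∘ component ℓ Y , a ∘ K.F₁ π₂ ⟩

    pairAlg-hom : ∀ {X Y} {p : K.F₀ X ⇒ X} {a : K.F₀ Y ⇒ Y} {u : X ⇒ H.F₀ Y} {v : X ⇒ Y} →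
                  u ∘ p ≈ H.F₁ (a ♯) ∘ component ℓ Y ∘ K.F₁ ⟨ u , v ⟩ →
                  IsAlgebraHom K p a v → IsAlgebraHom K p (pairAlg a) ⟨ u , v ⟩
    pairAlg-hom p q = trans ⟨⟩∘ (trans
      (⟨⟩-cong (trans p (sym assoc))
               (trans q (trans (∘-congˡ (trans (K.F-cong (sym project₂)) K.homomorphism)) (sym assoc))))
      (sym ⟨⟩∘))

    -- The lifting of M to H-coalgebras induced by ℓ.
    module _ {X : Obj} (x : X ⇒ H.F₀ X) where
      pair : M₀ X ⇒ H.F₀ (M₀ X) × M₀ X
      pair = ext (pairAlg (φ X)) ⟨ H.F₁ (η X) ∘ x , η X ⟩

      lift : M₀ X ⇒ H.F₀ (M₀ X)
      lift = π₁ ∘ pair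

      π₂∘pair : π₂ ∘ pair ≈ id
      π₂∘pair = trans
        (sym (ext-unique
          (∘-hom {b = pairAlg (φ X)} project₂ (ext-hom _ _))
          (trans assoc (trans (∘-congˡ (ext-η _ _)) project₂))))
        (ext-unique id-hom identityˡ)

      pair≈ : ⟨ lift , id ⟩ ≈ pair
      pair≈ = unique refl π₂∘pair

      lift-bialgebra : IsBialgebra (φ X) lift
      lift-bialgebra = begin
        lift ∘ φ X                                                      ≈⟨ assoc ⟩
        π₁ ∘ (pair ∘ φ X)                                               ≈⟨ ∘-congˡ (ext-hom _ _) ⟩
        π₁ ∘ (pairAlg (φ X) ∘ K.F₁ pair)                                ≈⟨ pullˡ project₁ ⟩
        (H.F₁ (μ X) ∘ component ℓ (M₀ X)) ∘ K.F₁ pair                   ≈⟨ assoc ⟩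
        H.F₁ (μ X) ∘ component ℓ (M₀ X) ∘ K.F₁ pair
          ≈⟨ ∘-congˡ (∘-congˡ (K.F-cong pair≈)) ⟨
        H.F₁ (μ X) ∘ component ℓ (M₀ X) ∘ K.F₁ ⟨ lift , id ⟩            ∎
        where open HomReasoning

      lift-η : lift ∘ η X ≈ H.F₁ (η X) ∘ x
      lift-η = trans assoc (trans (∘-congˡ (ext-η _ _)) project₁)

    commute′ : ∀ {W X Y} {f : X ⇒ Y} {u : W ⇒ H.F₀ X} {v : W ⇒ X} →
               component ℓ Y ∘ K.F₁ ⟨ H.F₁ f ∘ u , f ∘ v ⟩
                 ≈ H.F₁ (M₁ f) ∘ component ℓ X ∘ K.F₁ ⟨ u , v ⟩
    commute′ {f = f} = trans
      (∘-congˡ (trans (K.F-cong (sym ×₁∘⟨⟩)) K.homomorphism))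
      (extendˡ (commute ℓ f))

    ext-coalgHom : ∀ {X Y} {x : X ⇒ H.F₀ X} {a : K.F₀ Y ⇒ Y} {y : Y ⇒ H.F₀ Y} {f : X ⇒ Y} →
                   IsBialgebra a y → IsCoalgebraHom H x y f → IsCoalgebraHom H (lift x) y (ext a f)
    ext-coalgHom {X} {Y} {x} {a} {y} {f} bi hom = begin
      y ∘ f*                          ≈⟨ pullˡ project₁ ⟨
      π₁ ∘ (⟨ y , id ⟩ ∘ f*)          ≈⟨ ∘-congˡ both ⟩
      π₁ ∘ ⟨ H.F₁ f* ∘ lift x , f* ⟩  ≈⟨ project₁ ⟩
      H.F₁ f* ∘ lift x                ∎
      where
        open HomReasoning
        f* : M₀ X ⇒ Y
        f* = ext a f

        first : (H.F₁ f* ∘ lift x) ∘ φ X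
                  ≈ H.F₁ (a ♯) ∘ component ℓ Y ∘ K.F₁ ⟨ H.F₁ f* ∘ lift x , f* ⟩
        first = begin
          (H.F₁ f* ∘ lift x) ∘ φ X
            ≈⟨ assoc ⟩
          H.F₁ f* ∘ (lift x ∘ φ X)
            ≈⟨ ∘-congˡ (lift-bialgebra x) ⟩
          H.F₁ f* ∘ (H.F₁ (μ X) ∘ component ℓ (M₀ X) ∘ K.F₁ ⟨ lift x , id ⟩)
            ≈⟨ extendˡ (trans (sym H.homomorphism) (trans (H.F-cong f*∘μ) H.homomorphism)) ⟩
          H.F₁ (a ♯) ∘ (H.F₁ (M₁ f*) ∘ component ℓ (M₀ X) ∘ K.F₁ ⟨ lift x , id ⟩)
            ≈⟨ ∘-congˡ commute′ ⟨
          H.F₁ (a ♯) ∘ component ℓ Y ∘ K.F₁ ⟨ H.F₁ f* ∘ lift x , f* ∘ id ⟩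
            ≈⟨ ∘-congˡ (∘-congˡ (K.F-cong (⟨⟩-cong refl identityʳ))) ⟩
          H.F₁ (a ♯) ∘ component ℓ Y ∘ K.F₁ ⟨ H.F₁ f* ∘ lift x , f* ⟩ ∎
          where
            f*∘μ : f* ∘ μ X ≈ a ♯ ∘ M₁ f*
            f*∘μ = trans (sym (hom∘ext (ext-hom _ _)))
              (trans (ext-unique (ext-hom _ _) (trans (ext-η _ _) (sym identityʳ))) (sym ♯∘M₁))

        both : ⟨ y , id ⟩ ∘ f* ≈ ⟨ H.F₁ f* ∘ lift x , f* ⟩
        both = trans
          (sym (hom∘ext (pairAlg-hom bi id-hom)))
          (ext-unique (pairAlg-hom first (ext-hom _ _))
            (begin
              ⟨ H.F₁ f* ∘ lift x , f* ⟩ ∘ η X            ≈⟨ ⟨⟩∘ ⟩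
              ⟨ (H.F₁ f* ∘ lift x) ∘ η X , f* ∘ η X ⟩
                ≈⟨ ⟨⟩-cong (begin
                     (H.F₁ f* ∘ lift x) ∘ η X     ≈⟨ assoc ⟩
                     H.F₁ f* ∘ (lift x ∘ η X)     ≈⟨ ∘-congˡ (lift-η x) ⟩
                     H.F₁ f* ∘ (H.F₁ (η X) ∘ x)   ≈⟨ pullˡ (trans (sym H.homomorphism) (H.F-cong (ext-η _ _))) ⟩
                     H.F₁ f ∘ x                   ≈⟨ hom ⟨
                     y ∘ f                        ∎)
                   (trans (ext-η _ _) (sym identityˡ)) ⟩
              ⟨ y ∘ f , id ∘ f ⟩                         ≈⟨ ⟨⟩∘ ⟨
              ⟨ y , id ⟩ ∘ f                             ∎))

    id-coalgHom : ∀ {X} {x : X ⇒ H.F₀ X} → IsCoalgebraHom H x x id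
    id-coalgHom = trans identityʳ (sym (trans (∘-congʳ H.identity) identityˡ))

    ∘-coalgHom : ∀ {X Y Z} {x : X ⇒ H.F₀ X} {y : Y ⇒ H.F₀ Y} {z : Z ⇒ H.F₀ Z} {g : Y ⇒ Z} {f : X ⇒ Y} →
                 IsCoalgebraHom H y z g → IsCoalgebraHom H x y f → IsCoalgebraHom H x z (g ∘ f)
    ∘-coalgHom p q = trans (extendˡ p) (trans (∘-congˡ q) (pullˡ (sym H.homomorphism)))

    β : M₀ C ⇒ C
    β = unfold (lift c)

    β∘η : β ∘ η C ≈ id
    β∘η = hom-unique (∘-coalgHom (unfold-hom (lift c)) (lift-η c)) id-coalgHom

    β∘μ : β ∘ μ C ≈ β ∘ M₁ β
    β∘μ = hom-unique
      (∘-coalgHom (unfold-hom (lift c)) (ext-coalgHom (lift-bialgebra c) id-coalgHom))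
      (∘-coalgHom (unfold-hom (lift c))
        (ext-coalgHom (lift-bialgebra c) (∘-coalgHom (lift-η c) (unfold-hom (lift c)))))

    b₀ : K.F₀ C ⇒ C
    b₀ = β ∘ κ C

    b₀♯ : b₀ ♯ ≈ β
    b₀♯ = ext-unique hom β∘η
      where
        open HomReasoning
        hom : β ∘ φ C ≈ b₀ ∘ K.F₁ β
        hom = begin
          β ∘ φ C                              ≈⟨ ∘-congˡ (trans (∘-congˡ K.identity) identityʳ) ⟨
          β ∘ (φ C ∘ K.F₁ id)                  ≈⟨ ∘-congˡ ext∘κ ⟨
          β ∘ (μ C ∘ κ (M₀ C))                 ≈⟨ extendˡ β∘μ ⟩
          β ∘ (M₁ β ∘ κ (M₀ C))                ≈⟨ ∘-congˡ ext∘κ ⟩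
          β ∘ (φ C ∘ K.F₁ (η C ∘ β))           ≈⟨ ∘-congˡ (∘-congˡ K.homomorphism) ⟩
          β ∘ (φ C ∘ (K.F₁ (η C) ∘ K.F₁ β))    ≈⟨ ∘-congˡ (sym assoc) ⟩
          β ∘ (κ C ∘ K.F₁ β)                   ≈⟨ assoc ⟨
          b₀ ∘ K.F₁ β                          ∎

    lift∘κ : lift c ∘ κ C ≈ component ℓ C ∘ K.F₁ ⟨ c , id ⟩
    lift∘κ = begin
      lift c ∘ (φ C ∘ K.F₁ (η C))
        ≈⟨ pullˡ (lift-bialgebra c) ⟩
      (H.F₁ (μ C) ∘ component ℓ (M₀ C) ∘ K.F₁ ⟨ lift c , id ⟩) ∘ K.F₁ (η C)
        ≈⟨ trans assoc (∘-congˡ assoc) ⟩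
      H.F₁ (μ C) ∘ component ℓ (M₀ C) ∘ (K.F₁ ⟨ lift c , id ⟩ ∘ K.F₁ (η C))
        ≈⟨ ∘-congˡ (∘-congˡ (trans (sym K.homomorphism) (K.F-cong pairη))) ⟩
      H.F₁ (μ C) ∘ component ℓ (M₀ C) ∘ K.F₁ ⟨ H.F₁ (η C) ∘ c , η C ∘ id ⟩
        ≈⟨ ∘-congˡ commute′ ⟩
      H.F₁ (μ C) ∘ (H.F₁ (M₁ (η C)) ∘ component ℓ C ∘ K.F₁ ⟨ c , id ⟩)
        ≈⟨ pullˡ (trans (sym H.homomorphism) (trans (H.F-cong μ∘Mη) H.identity)) ⟩
      id ∘ (component ℓ C ∘ K.F₁ ⟨ c , id ⟩)
        ≈⟨ identityˡ ⟩
      component ℓ C ∘ K.F₁ ⟨ c , id ⟩ ∎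
      where
        open HomReasoning
        pairη : ⟨ lift c , id ⟩ ∘ η C ≈ ⟨ H.F₁ (η C) ∘ c , η C ∘ id ⟩
        pairη = trans ⟨⟩∘ (⟨⟩-cong (lift-η c) (trans identityˡ (sym identityʳ)))
        μ∘Mη : μ C ∘ M₁ (η C) ≈ id
        μ∘Mη = trans ♯∘M₁ (ext-unique id-hom identityˡ)

    b₀-interpretation : IsInterpretation ℓ b₀
    b₀-interpretation = begin
      c ∘ (β ∘ κ C)                                        ≈⟨ extendˡ (unfold-hom (lift c)) ⟩
      H.F₁ β ∘ (lift c ∘ κ C)                              ≈⟨ ∘-cong (H.F-cong (sym b₀♯)) lift∘κ ⟩
      H.F₁ (b₀ ♯) ∘ component ℓ C ∘ K.F₁ ⟨ c , id ⟩        ∎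
      where open HomReasoning

    b₀-unique : ∀ {b} → IsInterpretation ℓ b → b₀ ≈ b
    b₀-unique {b} p = begin
      β ∘ κ C        ≈⟨ ∘-congʳ (hom-unique (unfold-hom (lift c)) (ext-coalgHom p id-coalgHom)) ⟩
      b ♯ ∘ κ C      ≈⟨ ext∘κ ⟩
      b ∘ K.F₁ id    ≈⟨ trans (∘-congˡ K.identity) identityʳ ⟩
      b              ∎
      where open HomReasoning

  interpretation-∃! : (ℓ : GSOSRule) → ∃! _≈_ (IsInterpretation ℓ)
  interpretation-∃! ℓ = b₀ ℓ , b₀-interpretation ℓ , b₀-unique ℓ

{-# OPTIONS --safe #-}

-- A solution s : X → C of e : X → MHMX + C amounts to a morphism t : HMX + C → C with
-- c · t = H(b♯ · Mt) · z for a guarded z : HMX + C → HM(HMX + C) built from e; one recovers s as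
-- b♯ · Mt · e′, where e′ : X → M(HMX + C).  Writing Z = HMX + C, the rule ℓ extends z along η_Z to an
-- H-coalgebra on MZ forming an ℓ-bialgebra with φ_Z, and the morphisms b♯ · Mt are exactly the
-- coalgebra homomorphisms from it to the terminal coalgebra.
module Submission where

open import Level using (Level)
open import Data.Product using (_,_)
open import Defs

module _ {o h e : Level} {𝒜 : Category o h e} (prod : BinaryProducts 𝒜)
         (H : Endofunctor 𝒜) (T : TerminalCoalgebra H)
         (K : Endofunctor 𝒜) (freeAlgebra : ∀ X → FreeAlgebra K X) where
  open Category 𝒜
  open TerminalCoalgebra T
  open FreeMonad K freeAlgebra
  open GSOS prod H T K freeAlgebra
  open NaturalTransformation using (component)
  private
    module H = Functor H
    module K = Functor K
    module M = Functor M

  -- Auxiliary facts on free algebras and the terminal coalgebra.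

  ext-cong : ∀ {X A} {a : K.F₀ A ⇒ A} {f g : X ⇒ A} → f ≈ g → ext a f ≈ ext a g
  ext-cong p = ext-unique (ext-hom _ _) (trans (ext-η _ _) (sym p))

  hom≈ext : ∀ {X A} {a : K.F₀ A ⇒ A} {g : M₀ X ⇒ A} →
            IsAlgebraHom K (φ X) a g → ext a (g ∘ η X) ≈ g
  hom≈ext p = ext-unique p refl

  hom∘♯ : ∀ {A B} {a : K.F₀ A ⇒ A} {b : K.F₀ B ⇒ B} {f : A ⇒ B} →
          IsAlgebraHom K a b f → f ∘ a ♯ ≈ b ♯ ∘ M₁ f
  hom∘♯ p = trans (sym (hom∘ext p)) (trans (ext-cong identityʳ) (sym ♯∘M₁))

  c-cancel : ∀ {X} {f : X ⇒ C} {g : X ⇒ H.F₀ C} → c ∘ f ≈ g → f ≈ c⁻¹ ∘ g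
  c-cancel p = trans (sym identityˡ) (trans (∘-congʳ (sym c⁻¹∘c)) (trans assoc (∘-congˡ p)))

  -- Bialgebras for `ℓ` and their coalgebra homomorphisms.

  module _ (ℓ : GSOSRule) where
    open BinaryProducts prod

    -- Naturality of `ℓ` enters here, so that comparing coalgebra structures along `f` becomes
    -- comparing two algebra homomorphisms into `pairAlg ℓ a`.
    pairAlg-hom-bialgebra : ∀ {X Y} {p : K.F₀ X ⇒ X} {x : X ⇒ H.F₀ X}
                            {a : K.F₀ Y ⇒ Y} {f : X ⇒ Y} →
                            IsBialgebra ℓ p x → IsAlgebraHom K p a f →
                            IsAlgebraHom K p (pairAlg ℓ a) ⟨ H.F₁ f ∘ x , f ⟩
    pairAlg-hom-bialgebra {X} {Y} {p} {x} {a} {f} bi hom = pairAlg-hom ℓ first hom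
      where
        open HomReasoning
        first : (H.F₁ f ∘ x) ∘ p ≈ H.F₁ (a ♯) ∘ component ℓ Y ∘ K.F₁ ⟨ H.F₁ f ∘ x , f ⟩
        first = begin
          (H.F₁ f ∘ x) ∘ p
            ≈⟨ trans assoc (∘-congˡ bi) ⟩
          H.F₁ f ∘ (H.F₁ (p ♯) ∘ component ℓ X ∘ K.F₁ ⟨ x , id ⟩)
            ≈⟨ extendˡ (trans (sym H.homomorphism) (trans (H.F-cong (hom∘♯ hom)) H.homomorphism)) ⟩
          H.F₁ (a ♯) ∘ (H.F₁ (M₁ f) ∘ component ℓ X ∘ K.F₁ ⟨ x , id ⟩)
            ≈⟨ ∘-congˡ (commute′ ℓ) ⟨
          H.F₁ (a ♯) ∘ component ℓ Y ∘ K.F₁ ⟨ H.F₁ f ∘ x , f ∘ id ⟩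
            ≈⟨ ∘-congˡ (∘-congˡ (K.F-cong (⟨⟩-cong refl identityʳ))) ⟩
          H.F₁ (a ♯) ∘ component ℓ Y ∘ K.F₁ ⟨ H.F₁ f ∘ x , f ⟩ ∎

    -- Both `⟨ y , id ⟩ ∘ f` and `⟨ H.F₁ f ∘ d , f ⟩` are homomorphisms from a free algebra into
    -- `pairAlg ℓ a`. They agree on generators, hence everywhere, and `π₁` extracts the claim.
    coalgHom-from-generators : ∀ {Z Y} {d : M₀ Z ⇒ H.F₀ (M₀ Z)} {a : K.F₀ Y ⇒ Y} {y : Y ⇒ H.F₀ Y}
                               {f : M₀ Z ⇒ Y} →
                               IsBialgebra ℓ (φ Z) d → IsBialgebra ℓ a y → IsAlgebraHom K (φ Z) a f →
                               y ∘ (f ∘ η Z) ≈ H.F₁ f ∘ (d ∘ η Z) → IsCoalgebraHom H d y f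
    coalgHom-from-generators {Z} {d = d} {a} {y} {f} biZ biY hom onη = begin
      y ∘ f                        ≈⟨ pullˡ project₁ ⟨
      π₁ ∘ (⟨ y , id ⟩ ∘ f)        ≈⟨ ∘-congˡ both ⟩
      π₁ ∘ ⟨ H.F₁ f ∘ d , f ⟩      ≈⟨ project₁ ⟩
      H.F₁ f ∘ d                   ∎
      where
        open HomReasoning
        agree : ⟨ H.F₁ f ∘ d , f ⟩ ∘ η Z ≈ (⟨ y , id ⟩ ∘ f) ∘ η Z
        agree = begin
          ⟨ H.F₁ f ∘ d , f ⟩ ∘ η Z              ≈⟨ ⟨⟩∘ ⟩
          ⟨ (H.F₁ f ∘ d) ∘ η Z , f ∘ η Z ⟩
            ≈⟨ ⟨⟩-cong (trans assoc (sym onη)) (sym identityˡ) ⟩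
          ⟨ y ∘ (f ∘ η Z) , id ∘ (f ∘ η Z) ⟩    ≈⟨ ⟨⟩∘ ⟨
          ⟨ y , id ⟩ ∘ (f ∘ η Z)                ≈⟨ assoc ⟨
          (⟨ y , id ⟩ ∘ f) ∘ η Z                ∎

        both : ⟨ y , id ⟩ ∘ f ≈ ⟨ H.F₁ f ∘ d , f ⟩
        both = trans
          (sym (hom≈ext (∘-hom (pairAlg-hom ℓ biY id-hom) hom)))
          (ext-unique (pairAlg-hom-bialgebra biZ hom) agree)

    -- Unlike `lift`, the generators may step to terms: the case z = H η ∘ x is `lift x`.
    module GuardedLift {Z : Obj} (z : Z ⇒ H.F₀ (M₀ Z)) where
      guardedPair : M₀ Z ⇒ H.F₀ (M₀ Z) × M₀ Z
      guardedPair = ext (pairAlg ℓ (φ Z)) ⟨ z , η Z ⟩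

      guardedLift : M₀ Z ⇒ H.F₀ (M₀ Z)
      guardedLift = π₁ ∘ guardedPair

      π₂∘guardedPair : π₂ ∘ guardedPair ≈ id
      π₂∘guardedPair = trans
        (sym (hom∘ext {a = pairAlg ℓ (φ Z)} project₂))
        (ext-unique id-hom (trans identityˡ (sym project₂)))

      guardedLift-bialgebra : IsBialgebra ℓ (φ Z) guardedLift
      guardedLift-bialgebra = begin
        guardedLift ∘ φ Z
          ≈⟨ trans assoc (∘-congˡ (ext-hom _ _)) ⟩
        π₁ ∘ (pairAlg ℓ (φ Z) ∘ K.F₁ guardedPair)
          ≈⟨ trans (pullˡ project₁) assoc ⟩
        H.F₁ (μ Z) ∘ component ℓ (M₀ Z) ∘ K.F₁ guardedPair
          ≈⟨ ∘-congˡ (∘-congˡ (K.F-cong (unique refl π₂∘guardedPair))) ⟨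
        H.F₁ (μ Z) ∘ component ℓ (M₀ Z) ∘ K.F₁ ⟨ guardedLift , id ⟩ ∎
        where open HomReasoning

      guardedLift-η : guardedLift ∘ η Z ≈ z
      guardedLift-η = trans assoc (trans (∘-congˡ (ext-η _ _)) project₁)

    -- Since `int` makes `b` and `c` a bialgebra, `unfold y ∘ a ♯` and `ext b (unfold y)` are both
    -- coalgebra homomorphisms from `lift ℓ y` to `c`, so terminality equates them. Precomposing
    -- with `κ Y` restricts this to single operations.
    unfold-algebraHom : ∀ {Y} {b : K.F₀ C ⇒ C} {a : K.F₀ Y ⇒ Y} {y : Y ⇒ H.F₀ Y} →
                        IsInterpretation ℓ b → IsBialgebra ℓ a y → IsAlgebraHom K a b (unfold y)
    unfold-algebraHom {Y} {b} {a} {y} int bi = begin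
      unfold y ∘ a                    ≈⟨ ∘-congˡ (trans (∘-congˡ K.identity) identityʳ) ⟨
      unfold y ∘ (a ∘ K.F₁ id)        ≈⟨ ∘-congˡ ext∘κ ⟨
      unfold y ∘ (a ♯ ∘ κ Y)          ≈⟨ pullˡ unfold∘♯ ⟩
      ext b (unfold y) ∘ κ Y          ≈⟨ ext∘κ ⟩
      b ∘ K.F₁ (unfold y)             ∎
      where
        open HomReasoning
        unfold∘♯ : unfold y ∘ a ♯ ≈ ext b (unfold y)
        unfold∘♯ = hom-unique
          (∘-coalgHom ℓ (unfold-hom y) (ext-coalgHom ℓ bi (id-coalgHom ℓ)))
          (ext-coalgHom ℓ int (unfold-hom y))

  -- Translating the solution equation into free algebras.

  module _ (coprod : BinaryCoproducts 𝒜) (ℓ : GSOSRule) (b : K.F₀ C ⇒ C)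
           (int : IsInterpretation ℓ b) where
    open BinaryCoproducts coprod

    +-ext : ∀ {X A B} {f g : A + B ⇒ X} → f ∘ i₁ ≈ g ∘ i₁ → f ∘ i₂ ≈ g ∘ i₂ → f ≈ g
    +-ext p q = trans (sym (unique p q)) (unique refl refl)

    k : H.F₀ (M₀ C) ⇒ C
    k = c⁻¹ ∘ H.F₁ (b ♯)

    k′ : M₀ (H.F₀ (M₀ C)) ⇒ C
    k′ = b ♯ ∘ M₁ k

    -- Parameters become variables, so a flat equation turns into a morphism into a free algebra.
    join : ∀ {A B} → M₀ A + B ⇒ M₀ (A + B)
    join = [ M₁ i₁ , η _ ∘ i₂ ]

    k∘HM : ∀ {X} (s : X ⇒ C) → k ∘ H.F₁ (M₁ s) ≈ c⁻¹ ∘ H.F₁ (ext b s)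
    k∘HM s = trans assoc (∘-congˡ (trans (sym H.homomorphism) (H.F-cong ♯∘M₁)))

    -- By `k∘HM` the hypotheses force `t` to be `[ k ∘ H.F₁ (M₁ s) , id ]`. For this `t`, solving
    -- `eq` means `s ≈ ext b t ∘ join ∘ eq`.
    ext∘join : ∀ {X} {s : X ⇒ C} {t : H.F₀ (M₀ X) + C ⇒ C} →
               t ∘ i₁ ≈ c⁻¹ ∘ H.F₁ (ext b s) → t ∘ i₂ ≈ id →
               ext b t ∘ join ≈ [ k′ , id ] ∘ (M₁ (H.F₁ (M₁ s)) +₁ id)
    ext∘join {X} {s} {t} p q = +-ext left right
      where
        open HomReasoning
        left : (ext b t ∘ join) ∘ i₁ ≈ ([ k′ , id ] ∘ (M₁ (H.F₁ (M₁ s)) +₁ id)) ∘ i₁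
        left = begin
          (ext b t ∘ join) ∘ i₁                             ≈⟨ trans assoc (∘-congˡ inject₁) ⟩
          ext b t ∘ M₁ i₁                                   ≈⟨ ∘-congʳ ♯∘M₁ ⟨
          (b ♯ ∘ M₁ t) ∘ M₁ i₁                              ≈⟨ assoc ⟩
          b ♯ ∘ (M₁ t ∘ M₁ i₁)                              ≈⟨ ∘-congˡ M.homomorphism ⟨
          b ♯ ∘ M₁ (t ∘ i₁)                                 ≈⟨ ∘-congˡ (M.F-cong (trans p (sym (k∘HM s)))) ⟩
          b ♯ ∘ M₁ (k ∘ H.F₁ (M₁ s))                        ≈⟨ ∘-congˡ M.homomorphism ⟩
          b ♯ ∘ (M₁ k ∘ M₁ (H.F₁ (M₁ s)))                   ≈⟨ assoc ⟨
          k′ ∘ M₁ (H.F₁ (M₁ s))                             ≈⟨ pullˡ inject₁ ⟨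
          [ k′ , id ] ∘ (i₁ ∘ M₁ (H.F₁ (M₁ s)))             ≈⟨ trans assoc (∘-congˡ inject₁) ⟨
          ([ k′ , id ] ∘ (M₁ (H.F₁ (M₁ s)) +₁ id)) ∘ i₁     ∎

        right : (ext b t ∘ join) ∘ i₂ ≈ ([ k′ , id ] ∘ (M₁ (H.F₁ (M₁ s)) +₁ id)) ∘ i₂
        right = begin
          (ext b t ∘ join) ∘ i₂                             ≈⟨ trans assoc (∘-congˡ inject₂) ⟩
          ext b t ∘ (η _ ∘ i₂)                              ≈⟨ pullˡ (ext-η _ _) ⟩
          t ∘ i₂                                            ≈⟨ q ⟩
          id                                                ≈⟨ trans (pullˡ inject₂) identityˡ ⟨
          [ k′ , id ] ∘ (i₂ ∘ id)                           ≈⟨ trans assoc (∘-congˡ inject₂) ⟨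
          ([ k′ , id ] ∘ (M₁ (H.F₁ (M₁ s)) +₁ id)) ∘ i₂     ∎

    -- Existence and uniqueness of solutions.

    module Solution {X : Obj} (eq : X ⇒ M₀ (H.F₀ (M₀ X)) + C) where
      Z : Obj
      Z = H.F₀ (M₀ X) + C

      eq′ : X ⇒ M₀ Z
      eq′ = join ∘ eq

      -- Under `H`, the variables of a term are replaced by `eq′`; parameters behave as in `c`. The
      -- `H` in the left summand of `Z` is the guard, so `eq′` may be arbitrary.
      step : Z ⇒ H.F₀ (M₀ Z)
      step = [ H.F₁ (ext (φ Z) eq′) , H.F₁ (η Z ∘ i₂) ∘ c ]

      open GuardedLift ℓ step

      u : M₀ Z ⇒ C
      u = unfold guardedLift

      solution : X ⇒ C
      solution = u ∘ eq′

      H∘step-i₁ : {f : M₀ Z ⇒ C} → IsAlgebraHom K (φ Z) b f →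
                  (H.F₁ f ∘ step) ∘ i₁ ≈ H.F₁ (ext b (f ∘ eq′))
      H∘step-i₁ hom = trans assoc (trans (∘-congˡ inject₁)
        (trans (sym H.homomorphism) (H.F-cong (sym (hom∘ext hom)))))

      H∘step-i₂ : {f : M₀ Z ⇒ C} → (H.F₁ f ∘ step) ∘ i₂ ≈ H.F₁ ((f ∘ η Z) ∘ i₂) ∘ c
      H∘step-i₂ = trans assoc (trans (∘-congˡ inject₂)
        (pullˡ (trans (sym H.homomorphism) (H.F-cong (sym assoc)))))

      u-hom : IsAlgebraHom K (φ Z) b u
      u-hom = unfold-algebraHom ℓ int guardedLift-bialgebra

      c∘u∘η : c ∘ (u ∘ η Z) ≈ H.F₁ u ∘ step
      c∘u∘η = trans (extendˡ (unfold-hom guardedLift)) (∘-congˡ guardedLift-η)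

      u∘η∘i₁ : (u ∘ η Z) ∘ i₁ ≈ c⁻¹ ∘ H.F₁ (ext b solution)
      u∘η∘i₁ = c-cancel (trans (pullˡ c∘u∘η) (H∘step-i₁ u-hom))

      -- Parameters are evaluated by a coalgebra endomorphism of the terminal coalgebra.
      u∘η∘i₂ : (u ∘ η Z) ∘ i₂ ≈ id
      u∘η∘i₂ = hom-unique (trans (pullˡ c∘u∘η) H∘step-i₂) (id-coalgHom ℓ)

      -- Being a homomorphism, `u` is the extension of `u ∘ η Z`, which meets the hypotheses of
      -- `ext∘join`.
      isSolution : IsSolution coprod (M ∘F H ∘F M) k′ eq solution
      isSolution = begin
        u ∘ (join ∘ eq)                                        ≈⟨ ∘-congʳ (hom≈ext u-hom) ⟨
        ext b (u ∘ η Z) ∘ (join ∘ eq)                          ≈⟨ extendˡ (ext∘join u∘η∘i₁ u∘η∘i₂) ⟩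
        [ k′ , id ] ∘ (M₁ (H.F₁ (M₁ solution)) +₁ id) ∘ eq     ∎
        where open HomReasoning

      -- Any solution factors through `eq′` by some `v` that is a coalgebra homomorphism from
      -- `guardedLift` to `c`, hence equal to `u`.
      isUnique : ∀ {s} → IsSolution coprod (M ∘F H ∘F M) k′ eq s → solution ≈ s
      isUnique {s} sol = trans (∘-congʳ (hom-unique (unfold-hom guardedLift) v-coalgHom)) (sym s≈v∘eq′)
        where
          open HomReasoning
          t : Z ⇒ C
          -- The only choice that meets the hypotheses of `ext∘join` for `s`.
          t = [ c⁻¹ ∘ H.F₁ (ext b s) , id ]

          v : M₀ Z ⇒ C
          v = ext b t

          s≈v∘eq′ : s ≈ v ∘ eq′
          s≈v∘eq′ = trans sol (sym (extendˡ (ext∘join inject₁ inject₂)))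

          c∘t : c ∘ t ≈ H.F₁ v ∘ step
          c∘t = +-ext
            (begin
              (c ∘ t) ∘ i₁                     ≈⟨ trans assoc (∘-congˡ inject₁) ⟩
              c ∘ (c⁻¹ ∘ H.F₁ (ext b s))       ≈⟨ trans (pullˡ c∘c⁻¹) identityˡ ⟩
              -- The solution property closes the loop: under `H` it turns `s` into `v ∘ eq′`,
              -- matching the substitution made by `step`.
              H.F₁ (ext b s)                   ≈⟨ H.F-cong (ext-cong s≈v∘eq′) ⟩
              H.F₁ (ext b (v ∘ eq′))           ≈⟨ H∘step-i₁ (ext-hom _ _) ⟨
              (H.F₁ v ∘ step) ∘ i₁             ∎)
            (begin
              (c ∘ t) ∘ i₂                     ≈⟨ trans assoc (∘-congˡ inject₂) ⟩
              c ∘ id                           ≈⟨ id-coalgHom ℓ ⟩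
              H.F₁ id ∘ c                      ≈⟨ ∘-congʳ (H.F-cong (trans (∘-congʳ (ext-η _ _)) inject₂)) ⟨
              H.F₁ ((v ∘ η Z) ∘ i₂) ∘ c        ≈⟨ H∘step-i₂ ⟨
              (H.F₁ v ∘ step) ∘ i₂             ∎)

          v-coalgHom : IsCoalgebraHom H guardedLift c v
          v-coalgHom = coalgHom-from-generators ℓ guardedLift-bialgebra int (ext-hom _ _)
            (trans (∘-congˡ (ext-η _ _)) (trans c∘t (∘-congˡ (sym guardedLift-η))))

mainTheorem3 : {o h e : Level} (𝒜 : Category o h e) (prod : BinaryProducts 𝒜) (coprod : BinaryCoproducts 𝒜)
  (H : Endofunctor 𝒜) (T : TerminalCoalgebra H)
  (K : Endofunctor 𝒜) (freeAlgebra : ∀ X → FreeAlgebra K X) →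
  let open Category 𝒜
      open TerminalCoalgebra T
      open FreeMonad K freeAlgebra
      open GSOS prod H T K freeAlgebra
  in (ℓ : GSOSRule) (b : Functor.F₀ K C ⇒ C) → IsInterpretation ℓ b →
     let k : Functor.F₀ (H ∘F M) C ⇒ C
         k = c⁻¹ ∘ Functor.F₁ H (b ♯)
         k′ : Functor.F₀ (M ∘F H ∘F M) C ⇒ C
         k′ = b ♯ ∘ Functor.F₁ M k
     in IsCompletelyIterative coprod (M ∘F H ∘F M) k′
mainTheorem3 𝒜 prod coprod H T K freeAlgebra ℓ b int eq = solution , isSolution , isUnique
  where open Solution prod H T K freeAlgebra coprod ℓ b int eq
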